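{- Given a set $X\subseteq A^*$ and an integer $k\ge 1$, the following conditions are equivalent: (i) For all $x,y\in X$, $\mathcal{F}_k(x)\cap\mathcal{F}_k(y)\ne\emptyset$ implies $x=y$. (ii) For every $x\in X$ we have $\mathcal{F}_{2k}(x)\cap X=\{x\}$. (iii) $\underline{\mathcal{F}_{2k}}(X)\cap X=\emptyset$.
   Context: $A$ is a finite alphabet with $|A|\ge 2$; $A^*$ is the free monoid over $A$ and $|w|$ is the length of $w$. For an integer $m\ge 1$, $(w,w')\in\mathcal{F}_m$ iff $|w|+|w'|-2|f|\le m$, where $f$ is a maximum length common factor (contiguous subword) of $w$ and $w'$; $\underline{\mathcal{F}_m}=\mathcal{F}_m\setminus\{(w,w):w\in A^*\}$. For a relation $\tau\subseteq A^*\times A^*$, $\tau(X)=\{y:\exists x\in X,\ (x,y)\in\tau\}$ and $\tau(x)=\tau(\{x\})$. -}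

module Defs where

open import Data.List.Base using (List; length)
open import Data.List.Relation.Binary.Infix.Heterogeneous using (Infix)
open import Data.Nat.Base using (ℕ; _+_; _*_; _∸_; _≤_)
open import Data.Product.Base using (_×_; ∃-syntax)
open import Level using (Level; _⊔_)
open import Relation.Binary.Core using (Rel)
open import Relation.Binary.PropositionalEquality.Core using (_≡_; _≢_)
open import Relation.Unary using (Pred; _∈_; ｛_｝)

private
  variable
    a r ℓ : Level

image : {B : Set a} → Rel B r → Pred B ℓ → Pred B (a ⊔ r ⊔ ℓ)
image τ X y = ∃[ x ] (x ∈ X × τ x y)

imageOf : {B : Set a} → Rel B r → B → Pred B (a ⊔ r)
imageOf τ x = image τ ｛ x ｝

module _ {A : Set a} where

  CommonFactor : List A → List A → List A → Set a
  CommonFactor w w′ f = Infix _≡_ f w × Infix _≡_ f w′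

  MaxCommonFactor : List A → List A → List A → Set a
  MaxCommonFactor w w′ f =
    CommonFactor w w′ f × (∀ g → CommonFactor w w′ g → length g ≤ length f)

  -- The subtraction never truncates, since a common factor is no longer than
  -- either word.
  𝓕 : ℕ → Rel (List A) a
  𝓕 m w w′ =
    ∃[ f ] (MaxCommonFactor w w′ f × (length w + length w′) ∸ 2 * length f ≤ m)

  𝓕̲ : ℕ → Rel (List A) a
  𝓕̲ m w w′ = 𝓕 m w w′ × w ≢ w′

{-# OPTIONS --safe #-}
module Submission where

-- The number |w| + |w′| − 2|f| behaves like a distance: two factors f and g of
-- z overlap in a factor of length at least |f| + |g| − |z|, which yields the
-- triangle inequality.  Conversely, words at distance at most j + k have an
-- intermediate word z at distances at most j and k: trim one of the two words
-- around f, where f stays a maximum length common factor of z and the other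
-- word.  Hence 𝓕 (2 * k) is the composite of 𝓕 k with itself.

open import Defs
open import Data.Fin.Base using (Fin)
open import Data.Fin.Properties using (inj⇒≟)
open import Data.List.Base using (List; []; _∷_; _++_; length; filter; inits)
open import Data.List.Extrema.Nat using (argmax; argmax-all; f[xs]≤f[argmax])
import Data.List.Membership.Propositional as List
open import Data.List.Membership.Propositional.Properties
  using ([]∈inits; ∈-map⁺; ∈-++⁺ˡ; ∈-++⁺ʳ; ∈-filter⁺)
open import Data.List.Properties using (≡-dec)
import Data.List.Relation.Binary.Infix.Heterogeneous.Properties as Infix
open import Data.List.Relation.Binary.Infix.Heterogeneous
  using (Infix; here; there)
import Data.List.Relation.Binary.Pointwise as Pointwise
open import Data.List.Relation.Binary.Prefix.Heterogeneous
  using (Prefix; []; _∷_)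
import Data.List.Relation.Binary.Prefix.Heterogeneous.Properties as Prefix
import Data.List.Relation.Unary.All as All
open import Data.List.Relation.Unary.All.Properties using (all-filter)
open import Data.Nat.Base using (ℕ; zero; suc; _+_; _*_; _∸_; _⊔_; _≤_; z≤n; s≤s)
open import Data.Nat.Properties hiding (_≟_)
open import Data.Nat.Tactic.RingSolver using (solve-∀)
open import Data.Product.Base using (_×_; _,_; proj₁; ∃-syntax; swap)
open import Data.Sum.Base using (inj₁; inj₂)
open import Function.Bundles using (_↔_; _⇔_; mk⇔)
open import Function.Properties.Inverse using (↔⇒↣)
open import Level using (Level)
open import Relation.Binary.Definitions using (DecidableEquality)
open import Relation.Binary.PropositionalEquality
  using (_≡_; refl; sym; trans; cong; subst)
open import Relation.Nullary.Decidable using (_×-dec_; decidable-stable)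
open import Relation.Unary using (Pred; Decidable; _∈_; _∩_; _≐_; ∅; ｛_｝; Satisfiable)

private
  variable
    a : Level
    A : Set a
    f g w x y z : List A
    j k n : ℕ

-- Overlap of two factors of a word.

infix-refl : Infix _≡_ w w
infix-refl = Infix.fromPointwise (Pointwise.refl refl)

infix-trans : Infix _≡_ x y → Infix _≡_ y z → Infix _≡_ x z
infix-trans = Infix.trans trans

-- Here `h` is the shorter of `f` and `g`, and the longer one fits into `z`.
prefix-overlap : Prefix _≡_ f z → Prefix _≡_ g z →
  ∃[ h ] (Prefix _≡_ h f × Prefix _≡_ h g × length f + length g ≤ length h + length z)
prefix-overlap []         q          = [] , [] , [] , Prefix.length-mono q
prefix-overlap p@(_ ∷ _)  []         =
  [] , [] , [] , ≤-trans (≤-reflexive (+-identityʳ _)) (Prefix.length-mono p)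
prefix-overlap {f = _ ∷ f} {z = _ ∷ z} {g = _ ∷ g} (refl ∷ p) (refl ∷ q) =
  let h , h⊑f , h⊑g , le = prefix-overlap p q
  in _ ∷ h , refl ∷ h⊑f , refl ∷ h⊑g , s≤s (begin
       length f + suc (length g)  ≡⟨ +-suc _ _ ⟩
       suc (length f + length g)  ≤⟨ s≤s le ⟩
       suc (length h + length z)  ≡⟨ +-suc _ _ ⟨
       length h + suc (length z)  ∎)
  where open ≤-Reasoning

-- Read `z` from the left. A letter before both factors only adds slack; a letter in the one that
-- starts first lowers both sides by one. Once both have started, what remains of them are prefixes.
infix-overlap : Infix _≡_ f z → Infix _≡_ g z →
  ∃[ h ] (Infix _≡_ h f × Infix _≡_ h g × length f + length g ≤ length h + length z)
infix-overlap (here p) (here q) =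
  let h , h⊑f , h⊑g , le = prefix-overlap p q in h , here h⊑f , here h⊑g , le
-- `f` is used up before `g` starts, so the overlap is empty.
infix-overlap (here []) (there q) =
  [] , here [] , here [] , m≤n⇒m≤1+n (Infix.length-mono q)
infix-overlap (here (refl ∷ p)) (there q) =
  let h , h⊑f , h⊑g , le = infix-overlap (here p) q
  in h , there h⊑f , h⊑g , ≤-trans (s≤s le) (≤-reflexive (sym (+-suc _ _)))
infix-overlap (there p) (here []) =
  [] , here [] , here [] ,
  ≤-trans (≤-reflexive (+-identityʳ _)) (m≤n⇒m≤1+n (Infix.length-mono p))
infix-overlap (there p) (here (refl ∷ q)) =
  let h , h⊑f , h⊑g , le = infix-overlap p (here q)
  in h , h⊑f , there h⊑g ,
     ≤-trans (≤-reflexive (+-suc _ _)) (≤-trans (s≤s le) (≤-reflexive (sym (+-suc _ _))))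
infix-overlap (there p) (there q) =
  let h , h⊑f , h⊑g , le = infix-overlap p q
  in h , h⊑f , h⊑g , ≤-trans le (+-monoʳ-≤ (length h) (n≤1+n _))

-- Words of prescribed length between a factor and a word.

prefix-interpolate : Prefix _≡_ f x → length f ≤ n → n ≤ length x →
  ∃[ z ] (Prefix _≡_ f z × Prefix _≡_ z x × length z ≡ n)
prefix-interpolate {n = zero} [] _ _ = [] , [] , [] , refl
prefix-interpolate {x = _ ∷ _} {n = suc _} [] _ (s≤s n≤x) =
  let z , _ , z⊑x , eq = prefix-interpolate [] z≤n n≤x
  in _ ∷ z , [] , refl ∷ z⊑x , cong suc eq
prefix-interpolate {n = suc _} (refl ∷ p) (s≤s f≤n) (s≤s n≤x) =
  let z , f⊑z , z⊑x , eq = prefix-interpolate p f≤n n≤x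
  in _ ∷ z , refl ∷ f⊑z , refl ∷ z⊑x , cong suc eq

-- Letters of `x` are dropped on the left until length `n` or the start of `f` is reached; any
-- surplus is then cut on the right.
infix-interpolate : Infix _≡_ f x → length f ≤ n → n ≤ length x →
  ∃[ z ] (Infix _≡_ f z × Infix _≡_ z x × length z ≡ n)
infix-interpolate (here p) f≤n n≤x =
  let z , f⊑z , z⊑x , eq = prefix-interpolate p f≤n n≤x in z , here f⊑z , here z⊑x , eq
infix-interpolate (there p) f≤n n≤x with m≤n⇒m<n∨m≡n n≤x
... | inj₁ (s≤s n≤x′) =
  let z , f⊑z , z⊑x , eq = infix-interpolate p f≤n n≤x′ in z , f⊑z , there z⊑x , eq
... | inj₂ n≡x = _ , there p , infix-refl , sym n≡x

-- Existence of a maximum length common factor.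

factors : List A → List (List A)
factors []          = inits []
factors w@(_ ∷ w′)  = inits w ++ factors w′

prefix⇒∈inits : Prefix _≡_ f w → f List.∈ inits w
prefix⇒∈inits {w = w} [] = []∈inits w
prefix⇒∈inits (refl ∷ p) = ∈-++⁺ʳ ([] ∷ []) (∈-map⁺ (_ ∷_) (prefix⇒∈inits p))

infix⇒∈factors : Infix _≡_ f w → f List.∈ factors w
infix⇒∈factors {w = []}    (here p)  = prefix⇒∈inits p
infix⇒∈factors {w = _ ∷ _} (here p)  = ∈-++⁺ˡ (prefix⇒∈inits p)
infix⇒∈factors {w = w@(_ ∷ _)} (there p) = ∈-++⁺ʳ (inits w) (infix⇒∈factors p)

-- A finite search: every common factor is listed in `factors x`. The default `[]` of the `argmax`
-- is itself a common factor.
maxCommonFactor : DecidableEquality A → (x y : List A) → ∃[ f ] MaxCommonFactor x y f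
maxCommonFactor {A = A} _≟ᴬ_ x y = argmax length [] common
  , argmax-all length (here [] , here []) (all-filter common? (factors x))
  , λ g cf@(g⊑x , _) → All.lookup (f[xs]≤f[argmax] [] common)
      (∈-filter⁺ common? (infix⇒∈factors g⊑x) cf)
  where
  common? : Decidable (CommonFactor x y)
  common? f = Infix.infix? _≟ᴬ_ f x ×-dec Infix.infix? _≟ᴬ_ f y
  common : List (List A)
  common = filter common? (factors x)

-- Reflexivity, symmetry, composition and splitting of `𝓕`.

maxCommonFactor-infixˡ : Infix _≡_ z x → MaxCommonFactor x z z
maxCommonFactor-infixˡ z⊑x = (z⊑x , infix-refl) , λ _ (_ , g⊑z) → Infix.length-mono g⊑z

MaxCommonFactor-sym : MaxCommonFactor x y f → MaxCommonFactor y x f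
MaxCommonFactor-sym (cf , max) = swap cf , λ g c → max g (swap c)

m∸n≤o⇒m≤n+o : ∀ m n {o} → m ∸ n ≤ o → m ≤ n + o
m∸n≤o⇒m≤n+o m n le = ≤-trans (m≤n+m∸n m n) (+-monoʳ-≤ n le)

𝓕-sym : 𝓕 k x y → 𝓕 k y x
𝓕-sym {k = k} {x = x} (f , mcf , le) =
  f , MaxCommonFactor-sym mcf ,
  subst (λ s → s ∸ 2 * length f ≤ k) (+-comm (length x) _) le

𝓕-refl : 𝓕 k x x
𝓕-refl {x = x} = x , maxCommonFactor-infixˡ infix-refl ,
  m≤n+o⇒m∸n≤o _ (2 * length x) (≤-trans (≤-reflexive (double (length x))) (m≤m+n _ _))
  where
  double : ∀ n → n + n ≡ 2 * n
  double = solve-∀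

𝓕-trans : DecidableEquality A → {x y z : List A} → 𝓕 j x z → 𝓕 k z y → 𝓕 (j + k) x y
𝓕-trans {j = j} {k = k} _≟_ {x} {y} {z}
  (f , ((f⊑x , f⊑z) , _) , xz) (g , ((g⊑z , g⊑y) , _) , zy) =
  let h , h⊑f , h⊑g , fg≤hz = infix-overlap f⊑z g⊑z
      h′ , mcf@(_ , max)    = maxCommonFactor _≟_ x y
      h≤h′ = max h (infix-trans h⊑f f⊑x , infix-trans h⊑g g⊑y)
  -- Adding `2 * Z` to both sides makes the two given bounds applicable without any subtraction.
  in h′ , mcf , m≤n+o⇒m∸n≤o _ (2 * length h′) (+-cancelʳ-≤ (2 * Z) _ _ (begin
       (X + Y) + 2 * Z                             ≡⟨ lhs X Y Z ⟩
       (X + Z) + (Z + Y)                           ≤⟨ +-mono-≤ (m∸n≤o⇒m≤n+o _ (2 * length f) xz)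
                                                               (m∸n≤o⇒m≤n+o _ (2 * length g) zy) ⟩
       (2 * length f + j) + (2 * length g + k)     ≡⟨ mid (length f) (length g) j k ⟩
       2 * (length f + length g) + (j + k)         ≤⟨ +-monoˡ-≤ (j + k) (*-monoʳ-≤ 2 (≤-trans fg≤hz (+-monoˡ-≤ Z h≤h′))) ⟩
       2 * (length h′ + Z) + (j + k)               ≡⟨ rhs (length h′) Z (j + k) ⟩
       (2 * length h′ + (j + k)) + 2 * Z           ∎))
  where
  open ≤-Reasoning
  X = length x
  Y = length y
  Z = length z
  lhs : ∀ p q r → (p + q) + 2 * r ≡ (p + r) + (r + q)
  lhs = solve-∀
  mid : ∀ p q r s → (2 * p + r) + (2 * q + s) ≡ 2 * (p + q) + (r + s)
  mid = solve-∀
  rhs : ∀ p q r → 2 * (p + q) + r ≡ (2 * p + r) + 2 * q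
  rhs = solve-∀

-- The last hypothesis puts `f` itself within `k` of `y`, so trimming `x` may go all the way down to
-- `f`.
𝓕-split-near : ∀ j k {x y f : List A} → MaxCommonFactor x y f →
  length x + length y ≤ 2 * length f + (j + k) → length y ≤ length f + k →
  ∃[ z ] (𝓕 j x z × 𝓕 k z y)
𝓕-split-near j k {x} {y} {f} ((f⊑x , f⊑y) , max) xy≤ y≤f+k =
  -- `j` letters of `x` are removed, or fewer if that would cut into `f`.
  let z , f⊑z , z⊑x , z≡n = infix-interpolate f⊑x (m≤m⊔n F (X ∸ j))
                              (⊔-lub (Infix.length-mono f⊑x) (m∸n≤m X j))
  in z
   , (z , maxCommonFactor-infixˡ z⊑x , m≤n+o⇒m∸n≤o _ (2 * length z)
       (subst (λ l → X + l ≤ 2 * l + j) (sym z≡n) x-near))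
   , (f , ((f⊑z , f⊑y) , λ g (g⊑z , g⊑y) → max g (infix-trans g⊑z z⊑x , g⊑y))
       , m≤n+o⇒m∸n≤o _ (2 * F) (subst (λ l → l + Y ≤ 2 * F + k) (sym z≡n) y-near))
  where
  open ≤-Reasoning
  X = length x
  Y = length y
  F = length f
  N = F ⊔ (X ∸ j)
  shuffle : ∀ p q → (p + q) + q ≡ 2 * q + p
  shuffle = solve-∀
  regroup : ∀ p q r → 2 * r + (p + q) ≡ p + (2 * r + q)
  regroup = solve-∀
  unfold : ∀ p q → p + (p + q) ≡ 2 * p + q
  unfold = solve-∀

  x-near : X + N ≤ 2 * N + j
  x-near = begin
    X + N            ≤⟨ +-monoˡ-≤ N (m≤n+m∸n X j) ⟩
    j + (X ∸ j) + N  ≤⟨ +-monoˡ-≤ N (+-monoʳ-≤ j (m≤n⊔m F (X ∸ j))) ⟩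
    j + N + N        ≡⟨ shuffle j N ⟩
    2 * N + j        ∎

  -- This keeps `(2 * F + k) ∸ Y` from truncating below.
  Y≤2F+k : Y ≤ 2 * F + k
  Y≤2F+k = ≤-trans y≤f+k (+-monoˡ-≤ k (m≤m+n F _))

  trimmed : X ∸ j ≤ (2 * F + k) ∸ Y
  trimmed = m≤n+o⇒m∸n≤o X j (begin
    X                        ≤⟨ m+n≤o⇒m≤o∸n X (≤-trans xy≤ (≤-reflexive (regroup j k F))) ⟩
    (j + (2 * F + k)) ∸ Y    ≡⟨ +-∸-assoc j Y≤2F+k ⟩
    j + ((2 * F + k) ∸ Y)    ∎)

  y-near : N + Y ≤ 2 * F + k
  y-near = begin
    (F ⊔ (X ∸ j)) + Y        ≡⟨ +-distribʳ-⊔ Y F (X ∸ j) ⟩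
    -- Trimming down to `f` is covered by `y≤f+k`, trimming by `j` letters by the bound on `X + Y`.
    (F + Y) ⊔ ((X ∸ j) + Y)  ≤⟨ ⊔-lub (≤-trans (+-monoʳ-≤ F y≤f+k) (≤-reflexive (unfold F k)))
                                      (m≤o∸n⇒m+n≤o (X ∸ j) Y≤2F+k trimmed) ⟩
    2 * F + k                ∎

-- The excesses of `x` and `y` over `f` sum to at most `j + k`, so that of `y` is at most `k` or
-- that of `x` is at most `j`. In the second case `y` is trimmed instead.
𝓕-split : ∀ j k {x y : List A} → 𝓕 (j + k) x y → ∃[ z ] (𝓕 j x z × 𝓕 k z y)
𝓕-split j k {x} {y} (f , mcf , xy) with ≤-total (length y) (length f + k)
... | inj₁ y≤f+k = 𝓕-split-near j k mcf (m∸n≤o⇒m≤n+o _ (2 * length f) xy) y≤f+k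
... | inj₂ f+k≤y =
  let z , yz , zx = 𝓕-split-near k j (MaxCommonFactor-sym mcf) yx≤ x≤f+j
  in z , 𝓕-sym zx , 𝓕-sym yz
  where
  open ≤-Reasoning
  X = length x
  Y = length y
  F = length f
  xy≤ : X + Y ≤ 2 * F + (j + k)
  xy≤ = m∸n≤o⇒m≤n+o _ (2 * F) xy
  yx≤ : Y + X ≤ 2 * F + (k + j)
  yx≤ = begin
    Y + X            ≡⟨ +-comm Y X ⟩
    X + Y            ≤⟨ xy≤ ⟩
    2 * F + (j + k)  ≡⟨ cong (2 * F +_) (+-comm j k) ⟩
    2 * F + (k + j)  ∎
  regroup : ∀ p q r → 2 * p + (q + r) ≡ (p + q) + (p + r)
  regroup = solve-∀
  x≤f+j : X ≤ F + j
  x≤f+j = +-cancelʳ-≤ (F + k) X (F + j) (begin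
    X + (F + k)        ≤⟨ +-monoʳ-≤ X f+k≤y ⟩
    X + Y              ≤⟨ xy≤ ⟩
    2 * F + (j + k)    ≡⟨ regroup F j k ⟩
    (F + j) + (F + k)  ∎)

-- Equivalence of the three conditions on `X`.

lemma5p1 : ∀ {a ℓ : Level} {A : Set a} {n : ℕ} → A ↔ Fin n → 2 ≤ n →
    (X : Pred (List A) ℓ) (k : ℕ) → 1 ≤ k →
    let i   = ∀ x y → x ∈ X → y ∈ X →
              Satisfiable (imageOf (𝓕 k) x ∩ imageOf (𝓕 k) y) → x ≡ y
        ii  = ∀ x → x ∈ X → (imageOf (𝓕 (2 * k)) x ∩ X) ≐ ｛ x ｝
        iii = (image (𝓕̲ (2 * k)) X ∩ X) ≐ ∅
    in (i ⇔ ii) × (ii ⇔ iii)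
lemma5p1 {A = A} A↔Fin _ X k _ = mk⇔ i⇒ii ii⇒i , mk⇔ ii⇒iii iii⇒ii
  where
  _≟_ : DecidableEquality A
  _≟_ = inj⇒≟ (↔⇒↣ A↔Fin)

  2k≡k+k : 2 * k ≡ k + k
  2k≡k+k = cong (k +_) (+-identityʳ k)

  i⇒ii : _ → _
  i⇒ii i x x∈X =
      (λ { {y} ((_ , refl , xy) , y∈X) →
           -- The midpoint `z` lies in both balls of radius `k`.
           let z , xz , zy = 𝓕-split k k (subst (λ m → 𝓕 m x y) 2k≡k+k xy)
           in i x y x∈X y∈X (z , (x , refl , xz) , (y , refl , 𝓕-sym zy)) })
    , (λ { refl → (x , refl , 𝓕-refl) , x∈X })

  ii⇒i : _ → _
  ii⇒i ii x y x∈X y∈X (z , (_ , refl , xz) , (_ , refl , yz)) =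
    proj₁ (ii x x∈X)
      ((x , refl , subst (λ m → 𝓕 m x y) (sym 2k≡k+k) (𝓕-trans _≟_ xz (𝓕-sym yz))) , y∈X)

  ii⇒iii : _ → _
  ii⇒iii ii =
      (λ { ((x , x∈X , xy , x≢y) , y∈X) → x≢y (proj₁ (ii x x∈X) ((x , refl , xy) , y∈X)) })
    , λ ()

  iii⇒ii : _ → _
  iii⇒ii iii x x∈X =
      (λ { {y} ((_ , refl , xy) , y∈X) →
           -- Condition (iii) only refutes `x ≢ y`; decidable equality of words turns this into
           -- `x ≡ y`.
           decidable-stable (≡-dec _≟_ x y)
             (λ x≢y → proj₁ iii ((x , x∈X , xy , x≢y) , y∈X)) })
    , (λ { refl → (x , refl , 𝓕-refl) , x∈X })
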